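{- For every integer $m \geq 1$, there exist infinitely many $\{ -1,m\}$-perfect numbers.
   Context: Let $\mathcal{S} \subset \mathbb{Z}$. An integer $n > 1$ with positive divisors $1 = d_0 < d_1 < \cdots < d_r < d_{r+1} = n$ is called $\mathcal{S}$-perfect (of the first kind) if there exist $\lambda_1, \ldots, \lambda_r \in \mathcal{S}$ (not necessarily distinct) such that $1+\sum_{j=1}^{r}\lambda_j d_j = n$. (The divisor $1$ always has coefficient $1$, and every divisor $d$ with $1<d<n$ must receive a coefficient from $\mathcal{S}$.) -}

module Defs where

open import Data.Fin.Base using (Fin)
open import Data.Integer.Base using (ℤ; +_; 1ℤ; _+_; _*_)
open import Data.Integer.Properties using (+-0-commutativeMonoid)
open import Data.List.Base using (List; length; lookup; filter; upTo)
open import Data.Nat.Base using (ℕ; _<_)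
open import Data.Nat.Divisibility using (_∣?_)
open import Data.Nat.Properties using (_<?_)
open import Data.Product.Base using (_×_; ∃-syntax; Σ-syntax)
open import Level using (Level)
open import Relation.Binary.PropositionalEquality.Core using (_≡_)
open import Relation.Nullary.Decidable using (_×-dec_)
open import Relation.Unary using (Pred; _∈_)

open import Algebra.Properties.CommutativeMonoid.Sum +-0-commutativeMonoid using (sum-syntax)

private
  variable
    ℓ : Level

-- The divisors d₁ < ⋯ < dᵣ of n strictly between 1 and n, in increasing
-- order; the bound d < n comes from upTo n = 0 ∷ ⋯ ∷ n - 1 ∷ [].
innerDivisors : ℕ → List ℕ
innerDivisors n = filter (λ d → (1 <? d) ×-dec (d ∣? n)) (upTo n)

-- The position j : Fin r is zero-based, so lookup (innerDivisors n) j is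
-- the divisor usually written d_{j+1}.
Perfect : Pred ℤ ℓ → Pred ℕ ℓ
Perfect S n =
  let r   = length (innerDivisors n)
      d j = lookup (innerDivisors n) j
  in 1 < n ×
     (Σ[ c ∈ (Fin r → ℤ) ] (∀ j → c j ∈ S) ×
                               1ℤ + ∑[ j < r ] (c j * + d j) ≡ + n)

InfinitelyMany : Pred ℕ ℓ → Set ℓ
InfinitelyMany P = ∀ N → ∃[ n ] N < n × n ∈ P

{-# OPTIONS --safe #-}
module Submission where

open import Algebra.Bundles using (module AbelianGroup)
open import Data.Fin.Base as Fin using (toℕ; fromℕ<)
open import Data.Fin.Properties using (pigeonhole; fromℕ<-injective)
open import Data.Integer.Base as ℤ using (ℤ; 1ℤ; -1ℤ; +≤+)
import Data.Integer.Properties as ℤ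
import Data.Integer.Tactic.RingSolver as ℤ-Solver
open import Data.List.Base
  using (List; []; _∷_; _++_; map; length; lookup; cartesianProductWith; upTo; downFrom)
open import Data.List.Membership.Propositional using (_∈_)
open import Data.List.Membership.Propositional.Properties
open import Data.List.Membership.Propositional.Properties.WithK using (unique∧set⇒bag)
open import Data.List.Relation.Binary.BagAndSetEquality using (∼bag⇒↭)
open import Data.List.Relation.Binary.Permutation.Propositional
  using (_↭_; refl; prep; swap; ↭-trans; ↭-sym; ↭-reflexive)
open import Data.List.Relation.Binary.Permutation.Propositional.Properties
  using (++⁺ˡ; shift; drop-∷)
open import Data.List.Relation.Unary.All as All using ([]; _∷_)
open import Data.List.Relation.Unary.AllPairs using ([]; _∷_)
open import Data.List.Relation.Unary.Any using (here; there)
open import Data.List.Relation.Unary.Unique.Propositional using (Unique)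
open import Data.List.Relation.Unary.Unique.Propositional.Properties
  using (cartesianProductWith⁺; downFrom⁺; filter⁺; upTo⁺)
open import Data.Nat.Base
open import Data.Nat.Combinatorics hiding (_P_)
open import Data.Nat.Coprimality using (Coprime; coprime-divisor)
open import Data.Nat.Divisibility
open import Data.Nat.DivMod using (m/n*n≡m; m%n<n; m≡m%n+[m/n]*n)
open import Data.Nat.GCD
open import Data.Nat.ListAction using (sum)
open import Data.Nat.ListAction.Properties using (sum-↭)
open import Data.Nat.Primality
open import Data.Nat.Primality.Factorisation using (factorise)
open import Data.Nat.Properties
open import Data.Nat.Tactic.RingSolver using (solve-∀)
open import Data.Product.Base using (_×_; _,_; ∃-syntax; Σ-syntax; ∃₂; proj₁; proj₂)
open import Data.Sum.Base using (_⊎_; inj₁; inj₂; [_,_]′)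
open import Function.Bundles using (mk⇔)
open import Relation.Binary.Definitions using (tri<; tri≈; tri>)
open import Relation.Binary.PropositionalEquality
open import Relation.Nullary using (Dec; yes; no; contradiction)
open import Relation.Nullary.Decidable using (_×-dec_)
open import Relation.Unary using (｛_｝; _∪_) renaming (_∈_ to _∈ₚ_)
open import Defs

open import Algebra.Properties.CommutativeMonoid.Sum ℤ.+-0-commutativeMonoid using (sum-syntax)
open import Algebra.Properties.Group (AbelianGroup.group ℤ.+-0-abelianGroup) using (∙-cancelʳ)

-- Put M = m + 1. Since 1 + m P - Q = n and 1 + P + Q + n = σ(n), a choice of
-- coefficients works iff the sum P of the divisors with coefficient m satisfies
-- M P + 2 = σ(n).
--
-- Take n = 2 ^ a * p ^ k with p ≡ 1 mod M prime, 2 ^ a idempotent mod M, and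
-- k + 1 = 2 w where w = σ(2 ^ a) = 2 ^ (a + 1) - 1. Then w ^ 2 ≡ 1 and
-- σ(p ^ k) ≡ k + 1 mod M, so σ(n) ≡ 2 w ^ 2 ≡ 2. If 2 ^ a is large compared with
-- p, the divisors other than 1 and n grow slowly enough for their subset sums to
-- fill an interval [p - 1, Σ - (p - 1)], Σ being their total, and
-- (σ(n) - 2) / M lies in it.

private
  variable
    d k m p q x : ℕ

-- Fermat's little theorem

prime∣!⇒≤ : Prime p → p ∣ k ! → p ≤ k
prime∣!⇒≤ {k = zero}  pr p∣1 = contradiction (subst Prime (∣1⇒≡1 p∣1) pr) ¬prime[1]
prime∣!⇒≤ {k = suc k} pr p∣k! with euclidsLemma (suc k) (k !) pr p∣k!
... | inj₁ p∣1+k = ∣⇒≤ p∣1+k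
... | inj₂ p∣k   = m≤n⇒m≤1+n (prime∣!⇒≤ pr p∣k)

-- The product `(p C k) * (k ! * (p ∸ k) !)` is `p !`, and `p` divides neither factorial, both
-- having arguments below `p`.
prime∣C : Prime p → 0 < k → k < p → p ∣ p C k
prime∣C {p} {k} pr 0<k k<p with euclidsLemma (p C k) (k ! * (p ∸ k) !) pr p∣C*k![p∸k]!
  where
  instance _ = k !* (p ∸ k) !≢0
  p∣p! : ∀ {p} → Prime p → p ∣ p !
  p∣p! {suc p} _ = m∣m*n (p !)
  p∣p! {zero} pr = contradiction pr ¬prime[0]
  p∣C*k![p∸k]! : p ∣ (p C k) * (k ! * (p ∸ k) !)
  p∣C*k![p∸k]! = subst (p ∣_)
    (sym (trans (cong (_* (k ! * (p ∸ k) !)) (nCk≡n!/k![n-k]! (<⇒≤ k<p)))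
                (m/n*n≡m (k![n∸k]!∣n! (<⇒≤ k<p)))))
    (p∣p! pr)
... | inj₁ p∣C = p∣C
... | inj₂ p∣k![p∸k]! with euclidsLemma (k !) ((p ∸ k) !) pr p∣k![p∸k]!
...   | inj₁ p∣k!     = contradiction (prime∣!⇒≤ pr p∣k!) (<⇒≱ k<p)
...   | inj₂ p∣[p∸k]! = contradiction (prime∣!⇒≤ pr p∣[p∸k]!)
                          (<⇒≱ (∸-monoʳ-< 0<k (<⇒≤ k<p)))

-- The first `k` terms of the expansion of (1 + x)^n. The separate cut-off lets Pascal's rule be
-- proved by induction on the number of terms.
binomialSum : ℕ → ℕ → ℕ → ℕ
binomialSum n x zero    = 0
binomialSum n x (suc k) = binomialSum n x k + (n C k) * x ^ k

binomialSum-pascal : ∀ n x k →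
  binomialSum (suc n) x (suc k) ≡ binomialSum n x (suc k) + x * binomialSum n x k
binomialSum-pascal n x zero    = cong suc (sym (*-zeroʳ x))
binomialSum-pascal n x (suc k) = begin
  binomialSum (suc n) x (suc k) + (suc n C suc k) * (x * x ^ k)
    ≡⟨ cong₂ (λ s c → s + c * (x * x ^ k)) (binomialSum-pascal n x k)
             (sym (nCk+nC[k+1]≡[n+1]C[k+1] n k)) ⟩
  binomialSum n x (suc k) + x * binomialSum n x k + (n C k + n C suc k) * (x * x ^ k)
    ≡⟨ regroup (binomialSum n x (suc k)) x (binomialSum n x k) (n C k) (n C suc k) (x ^ k) ⟩
  binomialSum n x (suc (suc k)) + x * binomialSum n x (suc k) ∎
  where
  open ≡-Reasoning
  regroup : ∀ s x t c c′ y →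
    s + x * t + (c + c′) * (x * y) ≡ (s + c′ * (x * y)) + x * (t + c * y)
  regroup = solve-∀

binomial : ∀ n x → suc x ^ n ≡ binomialSum n x (suc n)
binomial zero    x = refl
binomial (suc n) x = begin
  suc x * suc x ^ n
    ≡⟨ cong (suc x *_) (binomial n x) ⟩
  binomialSum n x (suc n) + x * binomialSum n x (suc n)
    ≡⟨ cong (_+ x * binomialSum n x (suc n)) extend ⟩
  binomialSum n x (suc (suc n)) + x * binomialSum n x (suc n)
    ≡⟨ binomialSum-pascal n x (suc n) ⟨
  binomialSum (suc n) x (suc (suc n)) ∎
  where
  open ≡-Reasoning
  extend : binomialSum n x (suc n) ≡ binomialSum n x (suc (suc n))
  extend = sym (trans (cong (λ c → binomialSum n x (suc n) + c * x ^ suc n)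
                            (k>n⇒nCk≡0 (n<1+n n)))
                      (+-identityʳ _))

binomialSum-prime : ∀ x k → Prime p → k < p → ∃[ s ] binomialSum p x (suc k) ≡ 1 + p * s
binomialSum-prime {p} x zero    pr _   = 0 , cong suc (sym (*-zeroʳ p))
binomialSum-prime {p} x (suc k) pr k<p
  with s , eq ← binomialSum-prime x k pr (<-trans (n<1+n k) k<p)
     | divides c eq′ ← prime∣C pr z<s k<p =
  s + c * x ^ suc k ,
  trans (cong₂ (λ u v → u + v * x ^ suc k) eq eq′) (regroup p s c (x ^ suc k))
  where
  regroup : ∀ p s c y → 1 + p * s + c * p * y ≡ 1 + p * (s + c * y)
  regroup = solve-∀

-- Induction on `x`: in the expansion of (1 + x)^p, all terms but the first and the last are
-- multiples of `p`.
fermat : ∀ x → Prime p → ∃[ s ] x ^ p ≡ x + p * s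
fermat {zero}     x pr = contradiction pr ¬prime[0]
fermat {p@(suc p-1)} zero pr = 0 , sym (*-zeroʳ p)
fermat {p@(suc p-1)} (suc x) pr
  with s , eq ← binomialSum-prime x p-1 pr (n<1+n p-1)
     | t , eq′ ← fermat x pr = s + t , (begin
  suc x ^ p                              ≡⟨ binomial p x ⟩
  binomialSum p x p + (p C p) * x ^ p      ≡⟨ cong₂ (λ u v → u + v * x ^ p) eq (nCn≡1 p) ⟩
  1 + p * s + 1 * x ^ p                  ≡⟨ cong (λ u → 1 + p * s + 1 * u) eq′ ⟩
  1 + p * s + 1 * (x + p * t)            ≡⟨ regroup p s x t ⟩
  suc x + p * (s + t)                    ∎)
  where
  open ≡-Reasoning
  regroup : ∀ p s x t → 1 + p * s + 1 * (x + p * t) ≡ suc x + p * (s + t)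
  regroup = solve-∀

-- Primes ≡ 1 mod M

-- The geometric sum 1 + x + ... + x^(n-1). Thus `geo 2 (suc a)` is σ(2^a), and `geo 2 a` is 2^a -
-- 1.
geo : ℕ → ℕ → ℕ
geo x zero    = 0
geo x (suc n) = x ^ n + geo x n

^-geo : ∀ y n → suc y ^ n ≡ 1 + y * geo (suc y) n
^-geo y zero    = cong suc (sym (*-zeroʳ y))
^-geo y (suc n) = trans (cong (_+ y * suc y ^ n) (^-geo y n))
                        (regroup y (suc y ^ n) (geo (suc y) n))
  where
  regroup : ∀ y u g → 1 + y * g + y * u ≡ 1 + y * (u + g)
  regroup = solve-∀

-- Each of the `n` terms is a power of `suc y`, hence 1 modulo `y`.
geo-mod : ∀ y n → ∃[ s ] geo (suc y) n ≡ n + y * s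
geo-mod y zero    = 0 , sym (*-zeroʳ y)
geo-mod y (suc n) with s , eq ← geo-mod y n =
  geo (suc y) n + s ,
  trans (cong₂ _+_ (^-geo y n) eq) (regroup y n (geo (suc y) n) s)
  where
  regroup : ∀ y n g s → 1 + y * g + (n + y * s) ≡ suc n + y * (g + s)
  regroup = solve-∀

suc-pred-^ : ∀ x n .{{_ : NonZero x}} → suc (pred (x ^ n)) ≡ x ^ n
suc-pred-^ x n = suc-pred (x ^ n) {{m^n≢0 x n}}

pred-^-* : ∀ x d c .{{_ : NonZero x}} →
           pred (x ^ (d * c)) ≡ pred (x ^ d) * geo (x ^ d) c
pred-^-* x d c = begin
  pred (x ^ (d * c))              ≡⟨ cong pred (^-*-assoc x d c) ⟨
  pred ((x ^ d) ^ c)              ≡⟨ cong (λ z → pred (z ^ c)) (suc-pred-^ x d) ⟨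
  pred (suc y ^ c)                ≡⟨ cong pred (^-geo y c) ⟩
  y * geo (suc y) c               ≡⟨ cong (λ z → y * geo z c) (suc-pred-^ x d) ⟩
  pred (x ^ d) * geo (x ^ d) c    ∎
  where
  open ≡-Reasoning
  y = pred (x ^ d)

pred-^-∣ : ∀ x .{{_ : NonZero x}} → m ∣ k → pred (x ^ m) ∣ pred (x ^ k)
pred-^-∣ {m} x (divides c refl) =
  subst (λ e → pred (x ^ m) ∣ pred (x ^ e)) (*-comm m c)
    (subst (pred (x ^ m) ∣_) (sym (pred-^-* x m c)) (m∣m*n _))

-- From x^(d+e) - 1 = x^d (x^e - 1) + (x^d - 1): exponents can be subtracted, as in Euclid's
-- algorithm.
∣pred-^-+ : ∀ x d e .{{_ : NonZero x}} →
            q ∣ pred (x ^ (d + e)) → q ∣ pred (x ^ e) → q ∣ pred (x ^ d)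
∣pred-^-+ {q} x d e q∣d+e q∣e = ∣m+n∣m⇒∣n (subst (q ∣_) split q∣d+e) (∣n⇒∣m*n (suc u) q∣e)
  where
  open ≡-Reasoning
  u = pred (x ^ d)
  v = pred (x ^ e)
  regroup : ∀ u v → v + u * (1 + v) ≡ (1 + u) * v + u
  regroup = solve-∀
  split : pred (x ^ (d + e)) ≡ suc u * v + u
  split = begin
    pred (x ^ (d + e))    ≡⟨ cong pred (^-distribˡ-+-* x d e) ⟩
    pred (x ^ d * x ^ e)  ≡⟨ cong₂ (λ s t → pred (s * t)) (suc-pred-^ x d) (suc-pred-^ x e) ⟨
    v + u * suc v         ≡⟨ regroup u v ⟩
    suc u * v + u         ∎

-- Bézout with natural coefficients writes the gcd as a difference of a multiple of one exponent and
-- a multiple of the other.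
∣pred-^-gcd : ∀ x .{{_ : NonZero x}} a b →
              q ∣ pred (x ^ a) → q ∣ pred (x ^ b) → q ∣ pred (x ^ gcd a b)
∣pred-^-gcd {q} x a b q∣a q∣b with Bézout.identity (gcd-GCD a b)
... | Bézout.+- u v eq = ∣pred-^-+ x (gcd a b) (v * b)
        (subst (λ e → q ∣ pred (x ^ e)) (sym eq) (∣-trans q∣a (pred-^-∣ x (n∣m*n u))))
        (∣-trans q∣b (pred-^-∣ x (n∣m*n v)))
... | Bézout.-+ u v eq = ∣pred-^-+ x (gcd a b) (u * a)
        (subst (λ e → q ∣ pred (x ^ e)) (sym eq) (∣-trans q∣b (pred-^-∣ x (n∣m*n v))))
        (∣-trans q∣a (pred-^-∣ x (n∣m*n u)))

-- Modulo `d`, `X` is 1, so `X ^ j` is both 1 and 0.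
∣pred∧∣^⇒≡1 : ∀ X j .{{_ : NonZero X}} → d ∣ pred X → d ∣ X ^ j → d ≡ 1
∣pred∧∣^⇒≡1 {d} X j d∣X-1 d∣X^j = ∣1⇒≡1 (∣m+n∣m⇒∣n
  (subst (d ∣_) (trans (sym (suc-pred-^ X j)) (+-comm 1 _)) d∣X^j)
  (∣-trans (subst (d ∣_) (cong pred (sym (^-identityʳ X))) d∣X-1) (pred-^-∣ X (1∣ j))))

-- Powers and prime divisors

^-monoˡ-∣ : ∀ n → m ∣ k → m ^ n ∣ k ^ n
^-monoˡ-∣ zero    m∣k = ∣-refl
^-monoˡ-∣ (suc n) m∣k = *-pres-∣ m∣k (^-monoˡ-∣ n m∣k)

^-monoʳ-∣ : ∀ x → m ≤ k → x ^ m ∣ x ^ k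
^-monoʳ-∣ {m} {k} x m≤k = divides (x ^ (k ∸ m))
  (trans (cong (x ^_) (sym (m∸n+n≡m m≤k))) (^-distribˡ-+-* x (k ∸ m) m))

^-distribʳ-* : ∀ m n o → (m * n) ^ o ≡ m ^ o * n ^ o
^-distribʳ-* m n zero    = refl
^-distribʳ-* m n (suc o) = trans (cong (m * n *_) (^-distribʳ-* m n o))
                                 (regroup m n (m ^ o) (n ^ o))
  where
  regroup : ∀ m n u v → m * n * (u * v) ≡ m * u * (n * v)
  regroup = solve-∀

n<2^n : ∀ n → n < 2 ^ n
n<2^n zero    = z<s
n<2^n (suc n) = begin-strict
  suc n          ≤⟨ n<2^n n ⟩
  2 ^ n          <⟨ m<m*n (2 ^ n) 2 {{m^n≢0 2 n}} (n<1+n 1) ⟩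
  2 ^ n * 2      ≡⟨ *-comm (2 ^ n) 2 ⟩
  2 ^ suc n      ∎
  where open ≤-Reasoning

prime∣^⇒∣ : ∀ n → Prime p → p ∣ x ^ n → p ∣ x
prime∣^⇒∣ zero pr p∣1 = contradiction (subst Prime (∣1⇒≡1 p∣1) pr) ¬prime[1]
prime∣^⇒∣ {x = x} (suc n) pr p∣x^n with euclidsLemma x (x ^ n) pr p∣x^n
... | inj₁ p∣x = p∣x
... | inj₂ p∣x^n = prime∣^⇒∣ n pr p∣x^n

∃-prime-divisor : ∀ n .{{_ : NonZero n}} → n ≢ 1 → ∃[ p ] Prime p × p ∣ n
∃-prime-divisor n n≢1 with factorise n
... | record { factors = [] ; isFactorisation = eq } = contradiction eq n≢1
... | record { factors = p ∷ ps ; isFactorisation = eq ; factorsPrime = pr ∷ _ } =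
  p , pr , subst (p ∣_) (sym eq) (m∣m*n _)

prime^∣*⇒∣ˡ : ∀ t g → Prime p → p ∤ k → p ^ t ∣ g * k → p ^ t ∣ g
prime^∣*⇒∣ˡ zero g pr p∤k _ = 1∣ g
prime^∣*⇒∣ˡ {p} {k} (suc t) g pr p∤k p^t∣gk
  with euclidsLemma g k pr (m*n∣⇒m∣ p (p ^ t) p^t∣gk)
... | inj₂ p∣k = contradiction p∣k p∤k
... | inj₁ (divides h refl) =
  subst (p ^ suc t ∣_) (*-comm p h) (*-monoʳ-∣ p (prime^∣*⇒∣ˡ t h pr p∤k
    (*-cancelˡ-∣ p {{prime⇒nonZero pr}}
      (subst (p ^ suc t ∣_) (trans (cong (_* k) (*-comm h p)) (*-assoc p h k)) p^t∣gk))))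

-- Let g = gcd(d, m^t). If d/g had a prime factor p, then p would divide m but, by maximality of g,
-- not m^t/g. Then p^t, a divisor of m^t, would divide g and so d.
∣^suc⇒∣^ : ∀ t .{{_ : NonZero m}} →
           (∀ {p} → Prime p → p ∣ m → p ^ t ∤ d) → d ∣ m ^ suc t → d ∣ m ^ t
∣^suc⇒∣^ {m} {d} t small d∣m^1+t = go (c′ ≟ 1)
  where
  g = gcd d (m ^ t)
  instance
    d≢0 : NonZero d
    d≢0 = ≢-nonZero λ { refl → ≢-nonZero⁻¹ (m ^ suc t) {{m^n≢0 m (suc t)}} (0∣⇒≡0 d∣m^1+t) }
    g≢0 : NonZero g
    g≢0 = ≢-nonZero (gcd[m,n]≢0 d (m ^ t) (inj₁ (≢-nonZero⁻¹ d)))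
  g∣d = gcd[m,n]∣m d (m ^ t)
  g∣m^t = gcd[m,n]∣n d (m ^ t)
  c′ = quotient g∣d
  k′ = quotient g∣m^t
  go : Dec (c′ ≡ 1) → d ∣ m ^ t
  go (yes c′≡1) = subst (_∣ m ^ t)
    (sym (trans (_∣_.equality g∣d) (trans (cong (_* g) c′≡1) (*-identityˡ g)))) g∣m^t
  go (no c′≢1) with p , pr , p∣c′ ← ∃-prime-divisor c′ {{quotient≢0 g∣d}} c′≢1 =
    contradiction
      (∣-trans (prime^∣*⇒∣ˡ t g pr p∤k′
                 (subst (p ^ t ∣_) (m∣n⇒n≡m*quotient g∣m^t) (^-monoˡ-∣ t p∣m))) g∣d)
      (small pr p∣m)
    where
    p∣m : p ∣ m
    p∣m = prime∣^⇒∣ (suc t) pr (∣-trans p∣c′ (∣-trans (quotient-∣ g∣d) d∣m^1+t))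
    p∤k′ : p ∤ k′
    p∤k′ p∣k′ = ¬prime[1] (subst Prime (∣1⇒≡1 (*-cancelʳ-∣ g
      (subst (p * g ∣_) (sym (*-identityˡ g))
        (gcd-greatest (subst (p * g ∣_) (sym (_∣_.equality g∣d)) (*-monoˡ-∣ g p∣c′))
                      (subst (p * g ∣_) (sym (_∣_.equality g∣m^t)) (*-monoˡ-∣ g p∣k′)))))) pr)

-- Every prime factor of M ^ n - 1, n = M ^ (M + 1), that divides no
-- M ^ (e ^ M * M) - 1 with e a proper divisor of M is ≡ 1 mod M; there is one
-- because the product of the latter numbers is smaller than M ^ n - 1.
module _ (M : ℕ) (1<M : 1 < M) where

  private
    instance
      M≢0 : NonZero M
      M≢0 = >-nonZero (<-trans z<s 1<M)

    N = pred (M ^ M ^ suc M)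

    A : ℕ → ℕ
    A e = pred (M ^ (e ^ M * M))

  -- `G` is what is left of `N` after removing its common factors with `A e` for the divisors
  -- `e ≤ k` of `M`, and `P` bounds the loss. Each step replaces `G` by its gcd with the cofactor
  -- `B` of `A e` in `N`.
  sieve : ∀ k → k < M → ∃₂ λ P G → N ∣ P * G × G ∣ N × 0 < P × P ≤ M ^ (k * M ^ M) ×
          (∀ e → e ≤ k → e ∣ M → Coprime G (A e))
  sieve zero    _   = 1 , N , ∣-reflexive (sym (+-identityʳ N)) , ∣-refl , ≤-refl , ≤-refl ,
    λ { zero _ 0∣M → contradiction (0∣⇒≡0 0∣M) (≢-nonZero⁻¹ M) }
  sieve (suc k) k<M
    with P , G , N∣PG , G∣N , 0<P , P≤ , cop ← sieve k (<-trans (n<1+n k) k<M)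
       | suc k ∣? M
  ... | no  e∤M = P , G , N∣PG , G∣N , 0<P ,
        ≤-trans P≤ (^-monoʳ-≤ M (m≤n+m (k * M ^ M) (M ^ M))) ,
        λ e e≤ e∣M → [ (λ e<1+k → cop e (s≤s⁻¹ e<1+k) e∣M)
                     , (λ { refl → contradiction e∣M e∤M }) ]′ (m≤n⇒m<n∨m≡n e≤)
  ... | yes e∣M@(divides b M≡be) = P * A e , gcd G B , N∣ , ∣-trans gcd∣G G∣N , *-mono-≤ 0<P 0<A , P′≤ , cop′
    where
    e = suc k
    D = e ^ M * M
    B = geo (M ^ D) (b ^ M)
    gcd∣G = gcd[m,n]∣m G B
    M^M≡e^M*b^M : M ^ M ≡ e ^ M * b ^ M
    M^M≡e^M*b^M = trans (cong (_^ M) (trans M≡be (*-comm b e))) (^-distribʳ-* e b M)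
    1<b : 1 < b
    1<b = quotient>1 e∣M k<M
    N≡A*B : N ≡ A e * B
    N≡A*B = trans (cong (λ z → pred (M ^ z)) (begin
      M * M ^ M            ≡⟨ cong (M *_) M^M≡e^M*b^M ⟩
      M * (e ^ M * b ^ M)  ≡⟨ regroup M (e ^ M) (b ^ M) ⟩
      D * b ^ M            ∎)) (pred-^-* M D (b ^ M))
      where
      open ≡-Reasoning
      regroup : ∀ x y z → x * (y * z) ≡ y * x * z
      regroup = solve-∀
    -- `A e * gcd G B` is the gcd of `A e * G` and `N`, hence a multiple of `G`.
    N∣ : N ∣ P * A e * gcd G B
    N∣ = ∣-trans N∣PG (subst (P * G ∣_)
      (trans (cong (P *_) (sym (c*gcd[m,n]≡gcd[cm,cn] (A e) G B)))
             (sym (*-assoc P (A e) (gcd G B))))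
      (*-monoʳ-∣ P (gcd-greatest (n∣m*n (A e)) (subst (G ∣_) N≡A*B G∣N))))
    -- Since `e` is a proper divisor, `b` is at least 2, and M < 2^M ≤ b^M.
    D≤ : D ≤ M ^ M
    D≤ = begin
      e ^ M * M      ≤⟨ *-monoʳ-≤ (e ^ M) (≤-trans (<⇒≤ (n<2^n M)) (^-monoˡ-≤ M 1<b)) ⟩
      e ^ M * b ^ M  ≡⟨ M^M≡e^M*b^M ⟨
      M ^ M          ∎
      where open ≤-Reasoning
    1<M^D : 1 < M ^ D
    1<M^D = ^-monoʳ-< M 1<M (*-mono-≤ (m^n>0 e M) (>-nonZero⁻¹ M))
    0<A : 0 < A e
    0<A = s≤s⁻¹ (subst (1 <_) (sym (suc-pred-^ M D)) 1<M^D)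
    P′≤ : P * A e ≤ M ^ (suc k * M ^ M)
    P′≤ = begin
      P * A e                         ≤⟨ *-mono-≤ P≤ (≤-trans pred[n]≤n (^-monoʳ-≤ M D≤)) ⟩
      M ^ (k * M ^ M) * M ^ (M ^ M)   ≡⟨ *-comm _ (M ^ (M ^ M)) ⟩
      M ^ (M ^ M) * M ^ (k * M ^ M)   ≡⟨ ^-distribˡ-+-* M (M ^ M) (k * M ^ M) ⟨
      M ^ (suc k * M ^ M)             ∎
      where open ≤-Reasoning
    -- `B` has `b ^ M` terms, each 1 modulo `A e`. A common divisor thus divides `b ^ M`, hence a
    -- power of `M ^ D`, which is 1 modulo that divisor.
    A-B-coprime : Coprime (A e) B
    A-B-coprime {d} (d∣A , d∣B) with s , eq ← geo-mod (A e) (b ^ M) =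
      ∣pred∧∣^⇒≡1 (M ^ D) M {{m^n≢0 M D}} d∣A (∣-trans d∣b^M
        (∣-trans (^-monoˡ-∣ M (subst (b ∣_) (sym M≡be) (m∣m*n e))) (^-monoˡ-∣ M M∣M^D)))
      where
      d∣b^M : d ∣ b ^ M
      d∣b^M = ∣m+n∣m⇒∣n
        (subst (d ∣_) (trans (trans (cong (λ z → geo z (b ^ M)) (sym (suc-pred-^ M D))) eq)
                             (+-comm (b ^ M) _)) d∣B)
        (∣m⇒∣m*n s d∣A)
      M∣M^D : M ∣ M ^ D
      M∣M^D = subst (M ∣_) (cong (M ^_) (suc-pred D {{m*n≢0 (e ^ M) M {{m^n≢0 e M}}}}))
                (m∣m*n _)
    cop′ : ∀ e′ → e′ ≤ suc k → e′ ∣ M → Coprime (gcd G B) (A e′)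
    cop′ e′ e′≤ e′∣M (d∣g , d∣A) with m≤n⇒m<n∨m≡n e′≤
    ... | inj₁ e′<e = cop e′ (s≤s⁻¹ e′<e) e′∣M (∣-trans d∣g gcd∣G , d∣A)
    ... | inj₂ refl = A-B-coprime (d∣A , ∣-trans d∣g (gcd[m,n]∣n G B))

  private
    module Survivor {q : ℕ} (pr : Prime q) (q∣N : q ∣ N)
                    (q∤A : ∀ e → e < M → e ∣ M → q ∤ A e) where

      -- A multiple of the order of `M` modulo `q` that divides `q - 1`; it remains to show that `M`
      -- divides it.
      o = gcd (M ^ suc M) (pred q)
      o∣n = gcd[m,n]∣m (M ^ suc M) (pred q)
      c = quotient o∣n

      q∤M : q ∤ M
      q∤M q∣M = ¬prime[1] (subst Prime
        (∣pred∧∣^⇒≡1 (M ^ M ^ suc M) 1 {{m^n≢0 M (M ^ suc M)}} q∣N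
          (subst (q ∣_) (trans (cong (M ^_) (suc-pred (M ^ suc M) {{m^n≢0 M (suc M)}}))
                               (sym (^-identityʳ _)))
            (∣m⇒∣m*n (M ^ pred (M ^ suc M)) q∣M))) pr)

      q∣M^[q-1]-1 : q ∣ pred (M ^ pred q)
      q∣M^[q-1]-1 with s , eq ← fermat M pr =
        [ (λ q∣M → contradiction q∣M q∤M) , (λ q∣ → q∣) ]′
          (euclidsLemma M (pred (M ^ pred q)) pr (divides s
            (+-cancelˡ-≡ M _ _ (begin
              M + M * pred (M ^ pred q)    ≡⟨ *-suc M _ ⟨
              M * suc (pred (M ^ pred q))  ≡⟨ cong (M *_) (suc-pred-^ M (pred q)) ⟩
              M ^ suc (pred q)             ≡⟨ cong (M ^_) (suc-pred q {{prime⇒nonZero pr}}) ⟩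
              M ^ q                        ≡⟨ eq ⟩
              M + q * s                    ≡⟨ cong (M +_) (*-comm q s) ⟩
              M + s * q                    ∎))))
        where open ≡-Reasoning

      q∣M^o-1 : q ∣ pred (M ^ o)
      q∣M^o-1 = ∣pred-^-gcd M (M ^ suc M) (pred q) q∣N q∣M^[q-1]-1

      -- With M = e p, a factor p^M of `c` would make `o` divide e^M M, so `q` would divide `A e`.
      small : ∀ {p} → Prime p → p ∣ M → p ^ M ∤ c
      small {p} ppr (divides e M≡ep) (divides c′ c≡) =
        q∤A e e<M (subst (e ∣_) (sym M≡ep) (m∣m*n p))
          (∣-trans q∣M^o-1 (pred-^-∣ M (divides c′ D≡)))
        where
        open ≡-Reasoning
        instance
          p≢0 = prime⇒nonZero ppr
          p>1 = prime⇒nonTrivial ppr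
          e≢0 : NonZero e
          e≢0 = ≢-nonZero λ { refl → ≢-nonZero⁻¹ M M≡ep }
        e<M : e < M
        e<M = subst (e <_) (sym M≡ep) (m<m*n e p (nonTrivial⇒n>1 p))
        regroup₁ : ∀ x y z → x * y * z ≡ y * (x * z)
        regroup₁ = solve-∀
        regroup₂ : ∀ x y z → x * y * z ≡ x * z * y
        regroup₂ = solve-∀
        D≡ : e ^ M * M ≡ c′ * o
        D≡ = *-cancelʳ-≡ _ _ (p ^ M) {{m^n≢0 p M}} (begin
          e ^ M * M * p ^ M    ≡⟨ regroup₁ (e ^ M) M (p ^ M) ⟩
          M * (e ^ M * p ^ M)  ≡⟨ cong (M *_) (^-distribʳ-* e p M) ⟨
          M * (e * p) ^ M      ≡⟨ cong (λ z → M * z ^ M) M≡ep ⟨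
          M ^ suc M            ≡⟨ _∣_.equality o∣n ⟩
          c * o                ≡⟨ cong (_* o) c≡ ⟩
          c′ * p ^ M * o       ≡⟨ regroup₂ c′ (p ^ M) o ⟩
          c′ * o * p ^ M       ∎)

      -- By `small`, `c` divides `M ^ M`; cancelling it from o c = M * M^M shows that `o` is a
      -- multiple of `M`.
      M∣q-1 : M ∣ pred q
      M∣q-1 with divides k M^M≡kc ← ∣^suc⇒∣^ M small (quotient-∣ o∣n) =
        ∣-trans (divides k (*-cancelʳ-≡ _ _ c {{c≢0}} (begin
          o * c        ≡⟨ m∣n⇒n≡m*quotient o∣n ⟨
          M * M ^ M    ≡⟨ cong (M *_) M^M≡kc ⟩
          M * (k * c)  ≡⟨ regroup M k c ⟩
          k * M * c    ∎))) (gcd[m,n]∣n (M ^ suc M) (pred q))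
        where
        open ≡-Reasoning
        c≢0 = quotient≢0 o∣n {{m^n≢0 M (suc M)}}
        regroup : ∀ x y z → x * (y * z) ≡ y * x * z
        regroup = solve-∀

  private
    -- The bound on `P` once all proper divisors of `M` are sieved; being below `N`, it forces `G`
    -- to be different from 1.
    X = M ^ (pred M * M ^ M)
    1<X : 1 < X
    1<X = ^-monoʳ-< M 1<M (*-mono-≤ (s≤s⁻¹ (subst (1 <_) (sym (suc-pred M)) 1<M))
                                    (m^n>0 M M))
    X<N : X < N
    X<N = s<s⁻¹ (begin-strict
      suc X              <⟨ +-monoˡ-< X 1<X ⟩
      X + X              ≡⟨ cong (X +_) (+-identityʳ X) ⟨
      2 * X              ≤⟨ *-monoˡ-≤ X (≤-trans 1<M (≤-trans (≤-reflexive (sym (^-identityʳ M)))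
                                                  (^-monoʳ-≤ M (m^n>0 M M)))) ⟩
      M ^ M ^ M * X      ≡⟨ ^-distribˡ-+-* M (M ^ M) (pred M * M ^ M) ⟨
      M ^ (suc (pred M) * M ^ M)  ≡⟨ cong (λ z → M ^ (z * M ^ M)) (suc-pred M) ⟩
      M ^ M ^ suc M      ≡⟨ suc-pred-^ M (M ^ suc M) ⟨
      suc N              ∎)
      where open ≤-Reasoning
    instance
      N≢0 : NonZero N
      N≢0 = >-nonZero (<-trans (<-trans z<s 1<X) X<N)
    G≢0 : ∀ {G} → G ∣ N → NonZero G
    G≢0 G∣N = ≢-nonZero λ { refl → ≢-nonZero⁻¹ N (0∣⇒≡0 G∣N) }
    G≢1 : ∀ {P G} → N ∣ P * G → 0 < P → P ≤ X → G ≢ 1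
    G≢1 {P} N∣PG 0<P P≤X refl = <⇒≱ X<N (≤-trans
      (∣⇒≤ {{>-nonZero 0<P}} (subst (N ∣_) (*-identityʳ P) N∣PG)) P≤X)

  ∃-prime≡1 : ∃[ q ] Prime q × M ∣ pred q
  ∃-prime≡1
    with P , G , N∣PG , G∣N , 0<P , P≤ , cop ← sieve (pred M) (≤-reflexive (suc-pred M))
    with q , pr , q∣G ← ∃-prime-divisor G {{G≢0 G∣N}} (G≢1 N∣PG 0<P P≤)
    = q , pr , Survivor.M∣q-1 pr (∣-trans q∣G G∣N)
        λ e e<M e∣M q∣A → ¬prime[1] (subst Prime
          (cop e (s≤s⁻¹ (subst (e <_) (sym (suc-pred M)) e<M)) e∣M (q∣G , q∣A)) pr)

-- Powers of two modulo M

2^≡1+geo : ∀ b → 2 ^ b ≡ 1 + geo 2 b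
2^≡1+geo b = trans (^-geo 1 b) (cong suc (*-identityˡ _))

-- Two equal powers 2 ^ i ≡ 2 ^ (i + t) mod M make 2 ^ a idempotent mod M for
-- every multiple a ≥ i of t.
∃-idempotent-2^ : ∀ M .{{_ : NonZero M}} K → ∃[ a ] K ≤ geo 2 a × M ∣ 2 ^ a * geo 2 a
∃-idempotent-2^ M K
  with i′ , j′ , i<j , eq ← pigeonhole (n<1+n M) (λ i → fromℕ< (m%n<n (2 ^ toℕ i) M)) =
  a , s≤s⁻¹ K<2^a , M∣
  where
  i = toℕ i′
  j = toℕ j′
  t = j ∸ i
  -- A multiple of `t` that is at least `i` and also at least `K`, so that 2^a - 1 ≥ K.
  a = t * (i + K)
  i+K≤a : i + K ≤ a
  i+K≤a = m≤n*m (i + K) t {{>-nonZero (m<n⇒0<n∸m i<j)}}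
  K<2^a : suc K ≤ suc (geo 2 a)
  K<2^a = ≤-trans (n<2^n K) (≤-trans (^-monoʳ-≤ 2 (≤-trans (m≤n+m K i) i+K≤a))
                                     (≤-reflexive (2^≡1+geo a)))
  2^j≡ : 2 ^ j ≡ 2 ^ i + 2 ^ i * geo 2 t
  2^j≡ = begin
    2 ^ j                    ≡⟨ cong (2 ^_) (m+[n∸m]≡n (<⇒≤ i<j)) ⟨
    2 ^ (i + t)              ≡⟨ ^-distribˡ-+-* 2 i t ⟩
    2 ^ i * 2 ^ t            ≡⟨ cong (2 ^ i *_) (2^≡1+geo t) ⟩
    2 ^ i * suc (geo 2 t)    ≡⟨ *-suc (2 ^ i) (geo 2 t) ⟩
    2 ^ i + 2 ^ i * geo 2 t  ∎
    where open ≡-Reasoning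
  M∣2^i*geo : M ∣ 2 ^ i * geo 2 t
  -- Cancelling the common remainder shows the difference of the two powers as a difference of
  -- multiples of `M`.
  M∣2^i*geo = ∣m+n∣m⇒∣n {m = 2 ^ i / M * M} (divides (2 ^ j / M)
    (+-cancelˡ-≡ (2 ^ i % M) _ _ (begin
      r + (2 ^ i / M * M + 2 ^ i * geo 2 t)  ≡⟨ +-assoc r _ _ ⟨
      r + 2 ^ i / M * M + 2 ^ i * geo 2 t    ≡⟨ cong (_+ 2 ^ i * geo 2 t) (m≡m%n+[m/n]*n (2 ^ i) M) ⟨
      2 ^ i + 2 ^ i * geo 2 t                ≡⟨ 2^j≡ ⟨
      2 ^ j                                  ≡⟨ m≡m%n+[m/n]*n (2 ^ j) M ⟩
      2 ^ j % M + 2 ^ j / M * M              ≡⟨ cong (_+ 2 ^ j / M * M) (fromℕ<-injective _ _ _ _ eq) ⟨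
      r + 2 ^ j / M * M                      ∎)))
    (n∣m*n (2 ^ i / M))
    where
    open ≡-Reasoning
    r = 2 ^ i % M
  M∣ : M ∣ 2 ^ a * geo 2 a
  M∣ = ∣-trans M∣2^i*geo (*-pres-∣ (^-monoʳ-∣ 2 (≤-trans (m≤m+n i K) i+K≤a))
    (subst₂ _∣_ (cong pred (2^≡1+geo t)) (cong pred (2^≡1+geo a)) (pred-^-∣ {m = t} 2 (m∣m*n (i + K)))))

-- Subset sums

private
  variable
    c lo s : ℕ
    xs ys : List ℕ

-- A decision for every entry: `take` will become the coefficient m, `skip` the coefficient -1.
data SubsetSum : List ℕ → ℕ → Set where
  []   : SubsetSum [] 0
  skip : SubsetSum xs s → SubsetSum (d ∷ xs) s
  take : SubsetSum xs s → SubsetSum (d ∷ xs) (d + s)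

x+[y+z]≡y+[x+z] : ∀ x y z → x + (y + z) ≡ y + (x + z)
x+[y+z]≡y+[x+z] = solve-∀

-- Transfers sums found for divisors arranged in rows to the increasing list `innerDivisors`.
SubsetSum-resp-↭ : xs ↭ ys → SubsetSum xs s → SubsetSum ys s
SubsetSum-resp-↭ refl σ = σ
SubsetSum-resp-↭ (prep d xs↭ys) (skip σ) = skip (SubsetSum-resp-↭ xs↭ys σ)
SubsetSum-resp-↭ (prep d xs↭ys) (take σ) = take (SubsetSum-resp-↭ xs↭ys σ)
SubsetSum-resp-↭ (swap d e xs↭ys) (skip (skip σ)) = skip (skip (SubsetSum-resp-↭ xs↭ys σ))
SubsetSum-resp-↭ (swap d e xs↭ys) (skip (take σ)) = take (skip (SubsetSum-resp-↭ xs↭ys σ))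
SubsetSum-resp-↭ (swap d e xs↭ys) (take (skip σ)) = skip (take (SubsetSum-resp-↭ xs↭ys σ))
SubsetSum-resp-↭ (swap d e xs↭ys) (take (take {s = s} σ)) =
  subst (SubsetSum _) (x+[y+z]≡y+[x+z] e d s) (take (take (SubsetSum-resp-↭ xs↭ys σ)))
SubsetSum-resp-↭ (_↭_.trans xs↭ys ys↭zs) σ = SubsetSum-resp-↭ ys↭zs (SubsetSum-resp-↭ xs↭ys σ)

Covers : ℕ → List ℕ → Set
Covers lo xs = ∀ t → lo ≤ t → t + lo ≤ sum xs → SubsetSum xs t

-- Sums without `d` fill an interval ending at `sum xs - lo`; those with `d` fill one starting at
-- `d + lo`. The hypothesis on `d` leaves no gap between the two.
covers-∷ : Covers lo xs → d + (lo + lo) ≤ suc (sum xs) → Covers lo (d ∷ xs)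
covers-∷ {lo} {xs} {d} cov d≤ t lo≤t t≤ with t + lo ≤? sum xs
... | yes t+lo≤ = skip (cov t lo≤t t+lo≤)
... | no  t+lo≰ = subst (SubsetSum (d ∷ xs)) (m+[n∸m]≡n (≤-trans (m≤m+n d lo) d+lo≤t))
                    (take (cov (t ∸ d) lo≤t∸d t∸d≤))
  where
  d+lo≤t : d + lo ≤ t
  d+lo≤t = +-cancelʳ-≤ lo (d + lo) t (≤-trans (≤-reflexive (+-assoc d lo lo))
             (≤-trans d≤ (≰⇒> t+lo≰)))
  lo≤t∸d : lo ≤ t ∸ d
  lo≤t∸d = m+n≤o⇒m≤o∸n lo (≤-trans (≤-reflexive (+-comm lo d)) d+lo≤t)
  t∸d≤ : t ∸ d + lo ≤ sum xs
  t∸d≤ = +-cancelˡ-≤ d _ _ (begin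
    d + (t ∸ d + lo)  ≡⟨ +-assoc d (t ∸ d) lo ⟨
    d + (t ∸ d) + lo  ≡⟨ cong (_+ lo) (m+[n∸m]≡n (≤-trans (m≤m+n d lo) d+lo≤t)) ⟩
    t + lo            ≤⟨ t≤ ⟩
    d + sum xs        ∎)
    where open ≤-Reasoning

doublings : ℕ → ℕ → List ℕ → List ℕ
doublings c b xs = map (λ i → 2 ^ i * c) (downFrom b) ++ xs

sum-doublings : ∀ c b xs → sum (doublings c b xs) ≡ geo 2 b * c + sum xs
sum-doublings c zero    xs = refl
sum-doublings c (suc b) xs = trans (cong (2 ^ b * c +_) (sum-doublings c b xs))
  (regroup (2 ^ b) c (geo 2 b) (sum xs))
  where
  regroup : ∀ u c g s → u * c + (g * c + s) ≡ (u + g) * c + s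
  regroup = solve-∀

2^*≡ : ∀ b c → 2 ^ b * c ≡ c + geo 2 b * c
2^*≡ b c = cong (_* c) (2^≡1+geo b)

-- The gap condition for `c` suffices: the entry 2^b c exceeds `c` by exactly the sum of the
-- doublings below it.
covers-doublings : ∀ b → Covers lo xs → c + (lo + lo) ≤ suc (sum xs) →
                   Covers lo (doublings c b xs)
covers-doublings zero cov c≤ = cov
covers-doublings {lo} {xs} {c} (suc b) cov c≤ =
  covers-∷ (covers-doublings b cov c≤) (begin
    2 ^ b * c + (lo + lo)          ≡⟨ cong (_+ (lo + lo)) (2^*≡ b c) ⟩
    c + geo 2 b * c + (lo + lo)    ≡⟨ regroup c (geo 2 b * c) (lo + lo) ⟩
    geo 2 b * c + (c + (lo + lo))  ≤⟨ +-monoʳ-≤ (geo 2 b * c) c≤ ⟩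
    geo 2 b * c + suc (sum xs)     ≡⟨ +-suc (geo 2 b * c) (sum xs) ⟩
    suc (geo 2 b * c + sum xs)     ≡⟨ cong suc (sum-doublings c b xs) ⟨
    suc (sum (doublings c b xs))   ∎)
  where
  open ≤-Reasoning
  regroup : ∀ x y z → x + y + z ≡ y + (x + z)
  regroup = solve-∀

-- The binary expansion of `x`, which has at most `b` digits.
multiples : ∀ c b x → x ≤ geo 2 b → SubsetSum (doublings c b []) (x * c)
multiples c zero    zero    _  = []
multiples c (suc b) x x≤ with x ≤? geo 2 b
... | yes x≤g = skip (multiples c b x x≤g)
... | no  x≰g = subst (SubsetSum _)
      (trans (sym (*-distribʳ-+ c (2 ^ b) (x ∸ 2 ^ b))) (cong (_* c) (m+[n∸m]≡n 2^b≤x)))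
      (take (multiples c b (x ∸ 2 ^ b) (m≤n+o⇒m∸n≤o x (2 ^ b) x≤)))
  where
  2^b≤x : 2 ^ b ≤ x
  2^b≤x = ≤-trans (≤-reflexive (2^≡1+geo b)) (≰⇒> x≰g)

even⊎odd : ∀ n → ∃[ k ] (n ≡ k * 2 ⊎ n ≡ suc (k * 2))
even⊎odd zero = 0 , inj₁ refl
even⊎odd (suc n) with even⊎odd n
... | k , inj₁ eq = k , inj₂ (cong suc eq)
... | k , inj₂ eq = suc k , inj₁ (cong suc eq)

*2≤suc*2⇒≤ : ∀ u v → u * 2 ≤ suc (v * 2) → u ≤ v
*2≤suc*2⇒≤ u v u*2≤ = s≤s⁻¹ (*-cancelʳ-< 2 u (suc v) (s≤s u*2≤))

sum-odd∷evens : ∀ h b → sum (suc (h * 2) ∷ doublings 2 b []) ≡ suc (geo 2 b * 2 + h * 2)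
sum-odd∷evens h b = trans (cong (suc (h * 2) +_) (sum-doublings 2 b []))
                          (regroup (h * 2) (geo 2 b * 2))
  where
  regroup : ∀ x y → suc x + (y + 0) ≡ suc (y + x)
  regroup = solve-∀

-- Even targets use only 2, 4, ..., 2^b. Odd targets also take the odd entry, and so must be at
-- least that entry: hence the bound `h * 2` at both ends.
covers-odd∷evens : ∀ h b → Covers (h * 2) (suc (h * 2) ∷ doublings 2 b [])
covers-odd∷evens h b t lo≤t t≤ with even⊎odd t | subst (t + h * 2 ≤_) (sum-odd∷evens h b) t≤
... | u , inj₁ refl | u*2+h*2≤ =
  skip (multiples 2 b u (*2≤suc*2⇒≤ u (geo 2 b) (+-cancelʳ-≤ (h * 2) _ _ u*2+h*2≤)))
... | u , inj₂ refl | 1+u*2+h*2≤ =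
  subst (SubsetSum _)
    (cong suc (trans (sym (*-distribʳ-+ 2 h (u ∸ h)))
                     (cong (_* 2) (m+[n∸m]≡n (*2≤suc*2⇒≤ h u lo≤t)))))
    (take (multiples 2 b (u ∸ h) (≤-trans (m∸n≤m u h) (*-cancelʳ-≤ u (geo 2 b) 2
      (+-cancelʳ-≤ (h * 2) _ _ (s≤s⁻¹ 1+u*2+h*2≤))))))

-- Divisors of 2 ^ a * p ^ k

prime∤⇒coprime : Prime p → p ∤ d → Coprime d p
prime∤⇒coprime pr p∤d (e∣d , e∣p) with prime⇒irreducible pr e∣p
... | inj₁ e≡1  = e≡1
... | inj₂ refl = contradiction e∣d p∤d

-- Factors `p` are stripped from `d` as long as possible; once `p` does not divide `d`, coprimality
-- removes the remaining powers of `p`.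
prime-power-split : ∀ k m → Prime p → d ∣ p ^ k * m →
                    ∃₂ λ i e → i ≤ k × d ≡ p ^ i * e × e ∣ m
prime-power-split {d = d} zero m pr d∣m =
  0 , d , z≤n , sym (*-identityˡ d) , subst (d ∣_) (*-identityˡ m) d∣m
prime-power-split {p} {d} (suc k) m pr d∣ with p ∣? d
... | yes (divides c refl)
  with i , e , i≤k , c≡ , e∣m ← prime-power-split k m pr
         (*-cancelˡ-∣ p {{prime⇒nonZero pr}} (subst₂ _∣_ (*-comm c p) (*-assoc p (p ^ k) m) d∣)) =
  suc i , e , s≤s i≤k ,
  trans (*-comm c p) (trans (cong (p *_) c≡) (sym (*-assoc p (p ^ i) e))) , e∣m
... | no p∤d
  with i , e , i≤k , d≡ , e∣m ← prime-power-split k m pr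
         (coprime-divisor (prime∤⇒coprime pr p∤d) (subst (d ∣_) (*-assoc p (p ^ k) m) d∣)) =
  i , e , m≤n⇒m≤1+n i≤k , d≡ , e∣m

^-injectiveʳ : ∀ {p} → 1 < p → ∀ i j → p ^ i ≡ p ^ j → i ≡ j
^-injectiveʳ {p} 1<p i j eq with <-cmp i j
... | tri< i<j _ _ = contradiction eq (<⇒≢ (^-monoʳ-< p 1<p i<j))
... | tri≈ _ i≡j _ = i≡j
... | tri> _ _ j<i = contradiction (sym eq) (<⇒≢ (^-monoʳ-< p 1<p j<i))

-- After common factors 2 are cancelled, an exponent of 2 left on one side only would make a power
-- of `p` even.
2^*^-injective : ∀ {p} → 1 < p → 2 ∤ p → ∀ i i′ j j′ →
                 2 ^ i * p ^ j ≡ 2 ^ i′ * p ^ j′ → j ≡ j′ × i ≡ i′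
2^*^-injective {p} 1<p 2∤p zero zero j j′ eq =
  ^-injectiveʳ 1<p j j′ (+-cancelʳ-≡ 0 _ _ eq) , refl
2^*^-injective {p} 1<p 2∤p zero (suc i′) j j′ eq =
  contradiction (prime∣^⇒∣ j prime[2] (subst (2 ∣_)
    (trans (sym eq) (*-identityˡ (p ^ j))) (∣m⇒∣m*n (p ^ j′) (m∣m*n (2 ^ i′))))) 2∤p
2^*^-injective {p} 1<p 2∤p (suc i) zero j j′ eq =
  contradiction (prime∣^⇒∣ j′ prime[2] (subst (2 ∣_)
    (trans eq (*-identityˡ (p ^ j′))) (∣m⇒∣m*n (p ^ j) (m∣m*n (2 ^ i))))) 2∤p
2^*^-injective {p} 1<p 2∤p (suc i) (suc i′) j j′ eq
  with j≡ , i≡ ← 2^*^-injective 1<p 2∤p i i′ j j′ (*-cancelˡ-≡ _ _ 2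
         (trans (sym (*-assoc 2 (2 ^ i) (p ^ j))) (trans eq (*-assoc 2 (2 ^ i′) (p ^ j′))))) =
  j≡ , cong suc i≡

-- For an odd prime `p`, the divisors of 2^(b-1) p^(k-1). The row of the highest power of `p` comes
-- first, so a new power puts one block of doublings in front.
grid : ℕ → ℕ → ℕ → List ℕ
grid p b k = cartesianProductWith (λ j i → 2 ^ i * p ^ j) (downFrom k) (downFrom b)

sum-grid : ∀ p b k → sum (grid p b k) ≡ geo 2 b * geo p k
sum-grid p b zero    = sym (*-zeroʳ (geo 2 b))
sum-grid p b (suc k) = begin
  sum (doublings (p ^ k) b (grid p b k))    ≡⟨ sum-doublings (p ^ k) b (grid p b k) ⟩
  geo 2 b * p ^ k + sum (grid p b k)        ≡⟨ cong (geo 2 b * p ^ k +_) (sum-grid p b k) ⟩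
  geo 2 b * p ^ k + geo 2 b * geo p k       ≡⟨ *-distribˡ-+ (geo 2 b) (p ^ k) (geo p k) ⟨
  geo 2 b * geo p (suc k)                   ∎
  where open ≡-Reasoning

module _ {p : ℕ} (pr : Prime p) (2∤p : 2 ∤ p) where

  private
    instance
      p≢0 = prime⇒nonZero pr
      p>1 = prime⇒nonTrivial pr

  grid-unique : ∀ b k → Unique (grid p b k)
  grid-unique b k = cartesianProductWith⁺ _
    (λ {j} {j′} {i} {i′} → 2^*^-injective (nonTrivial⇒n>1 p) 2∤p i i′ j j′)
    (downFrom⁺ k) (downFrom⁺ b)

  ∣⇒∈grid : ∀ a k → d ∣ 2 ^ a * p ^ k → d ∈ grid p (suc a) (suc k)
  ∣⇒∈grid {d} a k d∣n
    with i , e , i≤a , d≡ , e∣ ← prime-power-split a (p ^ k) prime[2] d∣n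
    with j , e′ , j≤k , e≡ , e′∣1 ← prime-power-split k 1 pr
           (subst (e ∣_) (sym (*-identityʳ (p ^ k))) e∣) =
    subst (_∈ grid p (suc a) (suc k))
      (sym (trans d≡ (cong (2 ^ i *_)
        (trans e≡ (trans (cong (p ^ j *_) (∣1⇒≡1 e′∣1)) (*-identityʳ (p ^ j)))))))
      (∈-cartesianProductWith⁺ _ (∈-downFrom⁺ (s≤s j≤k)) (∈-downFrom⁺ (s≤s i≤a)))

  ∈grid⇒∣ : ∀ a k → d ∈ grid p (suc a) (suc k) → d ∣ 2 ^ a * p ^ k
  ∈grid⇒∣ a k d∈
    with j , i , j∈ , i∈ , refl ← ∈-cartesianProductWith⁻ _ (downFrom (suc k)) (downFrom (suc a)) d∈ =
    *-pres-∣ (^-monoʳ-∣ 2 (s≤s⁻¹ (∈-downFrom⁻ i∈))) (^-monoʳ-∣ p (s≤s⁻¹ (∈-downFrom⁻ j∈)))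

  -- Both lists are free of duplicates and have the same members.
  divisors↭grid : ∀ a k → 1 < 2 ^ a * p ^ k →
    1 ∷ 2 ^ a * p ^ k ∷ innerDivisors (2 ^ a * p ^ k) ↭ grid p (suc a) (suc k)
  divisors↭grid a k 1<n =
    ∼bag⇒↭ (unique∧set⇒bag unique (grid-unique (suc a) (suc k)) (mk⇔ to from))
    where
    n = 2 ^ a * p ^ k
    P? = λ d → (1 <? d) ×-dec (d ∣? n)
    unique : Unique (1 ∷ n ∷ innerDivisors n)
    unique =
      (<⇒≢ 1<n ∷ All.tabulate λ d∈ → <⇒≢ (proj₁ (proj₂ (∈-filter⁻ P? {xs = upTo n} d∈)))) ∷
      All.tabulate (λ d∈ → ≢-sym (<⇒≢ (∈-upTo⁻ (proj₁ (∈-filter⁻ P? {xs = upTo n} d∈))))) ∷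
      filter⁺ P? (upTo⁺ n)
    to : d ∈ 1 ∷ n ∷ innerDivisors n → d ∈ grid p (suc a) (suc k)
    to (here refl)         = ∣⇒∈grid a k (1∣ n)
    to (there (here refl)) = ∣⇒∈grid a k ∣-refl
    to (there (there d∈))  = ∣⇒∈grid a k (proj₂ (proj₂ (∈-filter⁻ P? {xs = upTo n} d∈)))
    instance
      n≢0 : NonZero n
      n≢0 = >-nonZero (<-trans z<s 1<n)
    from : d ∈ grid p (suc a) (suc k) → d ∈ 1 ∷ n ∷ innerDivisors n
    from {d} d∈ with d∣n ← ∈grid⇒∣ a k d∈ with d ≟ 1 | d ≟ n
    ... | yes refl | _        = here refl
    ... | no _     | yes refl = there (here refl)
    ... | no d≢1   | no d≢n   = there (there (∈-filter⁺ P?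
          (∈-upTo⁺ (≤∧≢⇒< (∣⇒≤ d∣n) d≢n)) (≤∧≢⇒< (n≢0⇒n>0 d≢0) (≢-sym d≢1) , d∣n)))
      where
      d≢0 : d ≢ 0
      d≢0 refl = ≢-nonZero⁻¹ n (0∣⇒≡0 d∣n)

-- Divisors arranged in rows

doublings-suc : ∀ c b xs → doublings c (suc b) xs ≡ doublings (c * 2) b (c ∷ xs)
doublings-suc c zero    xs = cong (_∷ xs) (+-identityʳ c)
doublings-suc c (suc b) xs = cong₂ _∷_ (regroup (2 ^ b) c) (doublings-suc c b xs)
  where
  regroup : ∀ u c → 2 * u * c ≡ u * (c * 2)
  regroup = solve-∀

doublings-↭ : ∀ c b → xs ↭ d ∷ ys → doublings c b xs ↭ d ∷ doublings c b ys
doublings-↭ {d = d} {ys = ys} c b xs↭ = ↭-trans (++⁺ˡ _ xs↭) (shift d _ ys)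

-- The divisors of 2 ^ a * p ^ (1 + j) other than 1.
properRows : ℕ → ℕ → ℕ → List ℕ
properRows p a zero    = doublings (p * 2) a (p ∷ doublings 2 a [])
properRows p a (suc j) = doublings (p ^ (2 + j)) (suc a) (properRows p a j)

-- The two lowest rows are split at their least entries 1 and `p`. Then 1 moves to the front and `p`
-- stops just before the powers of 2, the shape in which the covering starts.
grid↭1∷properRows : ∀ p a j → grid p (suc a) (2 + j) ↭ 1 ∷ properRows p a j
grid↭1∷properRows p a zero = ↭-trans (↭-reflexive (begin
  doublings (p ^ 1) (suc a) (doublings 1 (suc a) [])
    ≡⟨ cong₂ (λ c → doublings c (suc a)) (*-identityʳ p) (doublings-suc 1 a []) ⟩
  doublings p (suc a) (doublings 2 a (1 ∷ []))
    ≡⟨ doublings-suc p a _ ⟩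
  doublings (p * 2) a (p ∷ doublings 2 a (1 ∷ [])) ∎))
  (doublings-↭ (p * 2) a (↭-trans (prep p (doublings-↭ 2 a refl)) (swap p 1 refl)))
  where open ≡-Reasoning
grid↭1∷properRows p a (suc j) = doublings-↭ (p ^ (2 + j)) (suc a) (grid↭1∷properRows p a j)

-- The divisors of 2 ^ a * p ^ (2 + j) other than 1 and the number itself.
innerRows : ℕ → ℕ → ℕ → List ℕ
innerRows p a j = doublings (p ^ (2 + j)) a (properRows p a j)

sum-properRows : ∀ p a j → suc (sum (properRows p a j)) ≡ geo 2 (suc a) * geo p (2 + j)
sum-properRows p a j = trans (sym (sum-↭ (grid↭1∷properRows p a j))) (sum-grid p (suc a) (2 + j))

grid↭n∷1∷innerRows : ∀ p a j →
  grid p (suc a) (3 + j) ↭ 2 ^ a * p ^ (2 + j) ∷ 1 ∷ innerRows p a j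
grid↭n∷1∷innerRows p a j = prep _ (doublings-↭ (p ^ (2 + j)) a (grid↭1∷properRows p a j))

-- Intervals filled by subset sums of the divisors

module _ (h a : ℕ) (3r≤w : suc (h * 2) * 3 ≤ geo 2 (suc a)) where

  private
    r = suc (h * 2)
    w = geo 2 (suc a)

  -- The gap condition for opening a new row: the preceding row sums to w r^(1+j) ≥ r^(2+j), and the
  -- rows below it add at least w ≥ 3r ≥ 4h.
  row≤ : ∀ j → r ^ (2 + j) + (h * 2 + h * 2) ≤ suc (sum (properRows r a j))
  row≤ j = begin
    r * r ^ (1 + j) + (h * 2 + h * 2)
      ≤⟨ +-mono-≤ (*-monoˡ-≤ (r ^ (1 + j)) (≤-trans (m≤m*n r 3) 3r≤w)) (≤-trans 4h≤3r 3r≤w) ⟩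
    w * r ^ (1 + j) + w
      ≤⟨ +-monoʳ-≤ (w * r ^ (1 + j)) (m≤m*n w (geo r (1 + j)) {{geo≢0}}) ⟩
    w * r ^ (1 + j) + w * geo r (1 + j)
      ≡⟨ *-distribˡ-+ w (r ^ (1 + j)) (geo r (1 + j)) ⟨
    w * geo r (2 + j)
      ≡⟨ sum-properRows r a j ⟨
    suc (sum (properRows r a j)) ∎
    where
    open ≤-Reasoning
    geo≢0 : NonZero (geo r (1 + j))
    geo≢0 = >-nonZero (≤-trans (m^n>0 r j) (m≤m+n (r ^ j) (geo r j)))
    4h≤3r : h * 2 + h * 2 ≤ r * 3
    4h≤3r = ≤-trans (m≤n+m _ (3 + h * 2)) (≤-reflexive (regroup (h * 2)))
      where
      regroup : ∀ x → 3 + x + (x + x) ≡ suc x * 3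
      regroup = solve-∀

  covers-properRows : ∀ j → Covers (h * 2) (properRows r a j)
  covers-properRows zero = covers-doublings a (covers-odd∷evens h a) (begin
    -- As r = 2h + 1, the left side is 4r - 2.
    r * 2 + (h * 2 + h * 2)             ≤⟨ n≤1+n _ ⟩
    suc (r * 2 + (h * 2 + h * 2))       ≤⟨ n≤1+n _ ⟩
    2 + (r * 2 + (h * 2 + h * 2))       ≡⟨ regroup₁ (h * 2) ⟩
    r + r * 3                           ≤⟨ +-monoʳ-≤ r 3r≤w ⟩
    r + (2 ^ a + geo 2 a)               ≡⟨ cong (λ z → r + (z + geo 2 a)) (2^≡1+geo a) ⟩
    r + (suc (geo 2 a) + geo 2 a)       ≡⟨ regroup₂ (h * 2) (geo 2 a) ⟩
    suc (suc (geo 2 a * 2 + h * 2))     ≡⟨ cong suc (sum-odd∷evens h a) ⟨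
    suc (sum (r ∷ doublings 2 a []))    ∎)
    where
    open ≤-Reasoning
    regroup₁ : ∀ x → 2 + (suc x * 2 + (x + x)) ≡ suc x + suc x * 3
    regroup₁ = solve-∀
    regroup₂ : ∀ x g → suc x + (suc g + g) ≡ suc (suc (g * 2 + x))
    regroup₂ = solve-∀
  covers-properRows (suc j) = covers-doublings (suc a) (covers-properRows j) (row≤ j)

  covers-innerRows : ∀ j → Covers (h * 2) (innerRows r a j)
  covers-innerRows j = covers-doublings a (covers-properRows j) (row≤ j)

-- The construction

-- The prime 2 is excluded because `M` would divide 1.
∃-odd-prime≡1 : ∀ M → 1 < M → ∃[ h ] Prime (suc (h * 2)) × M ∣ h * 2
∃-odd-prime≡1 M 1<M = odd (∃-prime≡1 M 1<M)
  where
  odd : ∃[ p ] Prime p × M ∣ pred p → ∃[ h ] Prime (suc (h * 2)) × M ∣ h * 2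
  odd (p , pr , M∣p-1) with even⊎odd p
  ... | h , inj₂ refl = h , pr , M∣p-1
  ... | h , inj₁ refl with prime⇒irreducible pr (n∣m*n h)
  ...   | inj₂ 2≡p =
    contradiction (∣1⇒≡1 (subst (λ q → M ∣ pred q) (sym 2≡p) M∣p-1)) (≢-sym (<⇒≢ 1<M))

2∤1+n*2 : ∀ n → 2 ∤ suc (n * 2)
2∤1+n*2 n 2∣ with () ← ∣1⇒≡1 (∣m+n∣m⇒∣n (subst (2 ∣_) (+-comm 1 (n * 2)) 2∣) (n∣m*n n))

innerDivisors↭innerRows : ∀ {p} → Prime p → 2 ∤ p → ∀ a j → 1 < 2 ^ a * p ^ (2 + j) →
  innerDivisors (2 ^ a * p ^ (2 + j)) ↭ innerRows p a j
innerDivisors↭innerRows {p} pr 2∤p a j 1<n = drop-∷ (drop-∷ (↭-trans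
  (divisors↭grid pr 2∤p a (2 + j) 1<n)
  (↭-trans (grid↭n∷1∷innerRows p a j) (swap _ 1 refl))))

-- With σ(n) = 1 + n + `sum (innerDivisors n)`, the equation is M P + 2 = σ(n) after cancelling 1.
Solution : ℕ → ℕ → Set
Solution M N = ∃[ n ] N < n × 1 < n ×
  ∃[ P ] SubsetSum (innerDivisors n) P × 1 + M * P ≡ n + sum (innerDivisors n)

-- The prime is 2h + 1. The lower bound on 2^a - 1 serves twice: the term M (2h + 1) gives the room
-- for the covering, the term `N` makes n exceed `N`.
module Construction
  (M : ℕ) (1<M : 1 < M) (N : ℕ)
  (h : ℕ) (pr : Prime (suc (h * 2))) (s : ℕ) (2h≡sM : h * 2 ≡ s * M)
  (a : ℕ) (K≤f : M * suc (h * 2) + N ≤ geo 2 a)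
  (z : ℕ) (2^a*f≡zM : 2 ^ a * geo 2 a ≡ z * M)
  where

  r = suc (h * 2)
  f = geo 2 a
  w = geo 2 (suc a)

  instance
    M≢0 : NonZero M
    M≢0 = >-nonZero (<-trans z<s 1<M)

  w≡ : w ≡ suc (f + f)
  w≡ = cong (_+ f) (2^≡1+geo a)

  Mr≤f : M * r ≤ f
  Mr≤f = ≤-trans (m≤m+n (M * r) N) K≤f

  2r≤f : 2 * r ≤ f
  2r≤f = ≤-trans (*-monoˡ-≤ r 1<M) Mr≤f

  3r≤w : r * 3 ≤ w
  3r≤w = begin
    r * 3           ≤⟨ m≤n+m (r * 3) r ⟩
    r + r * 3       ≡⟨ regroup r ⟩
    2 * r + 2 * r   ≤⟨ +-mono-≤ 2r≤f 2r≤f ⟩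
    f + f           ≤⟨ n≤1+n (f + f) ⟩
    suc (f + f)     ≡⟨ w≡ ⟨
    w               ∎
    where
    open ≤-Reasoning
    regroup : ∀ r → r + r * 3 ≡ 2 * r + 2 * r
    regroup = solve-∀

  3≤2w : 3 ≤ 2 * w
  3≤2w = ≤-trans (*-monoˡ-≤ 3 (s≤s (z≤n {h * 2}))) (≤-trans 3r≤w (m≤n*m w 2))

  -- The exponent of `r` is 2 + j, so r^(2+j) has 3 + j = 2w divisors.
  j = 2 * w ∸ 3
  3+j≡2w : 3 + j ≡ 2 * w
  3+j≡2w = m+[n∸m]≡n 3≤2w

  n = 2 ^ a * r ^ (2 + j)

  N<n : N < n
  N<n = begin-strict
    N                      ≤⟨ m≤n+m N (M * r) ⟩
    M * r + N              ≤⟨ K≤f ⟩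
    f                      <⟨ n<1+n f ⟩
    suc f                  ≡⟨ 2^≡1+geo a ⟨
    2 ^ a                  ≤⟨ m≤m*n (2 ^ a) (r ^ (2 + j)) {{m^n≢0 r (2 + j)}} ⟩
    n                      ∎
    where open ≤-Reasoning

  1<n : 1 < n
  1<n = *-mono-≤ (m^n>0 2 a) 1<r^
    where
    1<r^ : 1 < r ^ (2 + j)
    1<r^ = ^-monoʳ-< r (nonTrivial⇒n>1 r {{prime⇒nonTrivial pr}}) {0} {2 + j} z<s

  L = innerRows r a j

  σ = w * geo r (3 + j)

  σ≡n+1+ΣL : σ ≡ n + suc (sum L)
  σ≡n+1+ΣL = trans (sym (sum-grid r (suc a) (3 + j))) (sum-↭ (grid↭n∷1∷innerRows r a j))

  s′ = proj₁ (geo-mod (h * 2) (3 + j))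

  -- Read off from (σ - 2) / M: with w = 2f + 1, 2w² - 2 = 8 * 2^a * f = 8zM, and the rest of σ is w
  -- * 2h * s′ = w * sM * s′.
  P = 8 * z + w * (s * s′)

  σ≡2+MP : σ ≡ 2 + M * P
  σ≡2+MP = begin
    w * geo r (3 + j)
      ≡⟨ cong (w *_) (proj₂ (geo-mod (h * 2) (3 + j))) ⟩
    w * (3 + j + h * 2 * s′)
      ≡⟨ cong₂ (λ u v → w * (u + v * s′)) 3+j≡2w 2h≡sM ⟩
    w * (2 * w + s * M * s′)
      ≡⟨ regroup₁ w s M s′ ⟩
    2 * (w * w) + M * (w * (s * s′))
      ≡⟨ cong (λ u → 2 * (u * u) + M * (w * (s * s′))) w≡ ⟩
    2 * (suc (f + f) * suc (f + f)) + M * (w * (s * s′))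
      ≡⟨ regroup₂ f (M * (w * (s * s′))) ⟩
    2 + (8 * (suc f * f) + M * (w * (s * s′)))
      ≡⟨ cong (λ u → 2 + (8 * (u * f) + M * (w * (s * s′)))) (2^≡1+geo a) ⟨
    2 + (8 * (2 ^ a * f) + M * (w * (s * s′)))
      ≡⟨ cong (λ u → 2 + (8 * u + M * (w * (s * s′)))) 2^a*f≡zM ⟩
    2 + (8 * (z * M) + M * (w * (s * s′)))
      ≡⟨ regroup₃ z M (w * (s * s′)) ⟩
    2 + M * P ∎
    where
    open ≡-Reasoning
    regroup₁ : ∀ w s M s′ → w * (2 * w + s * M * s′) ≡ 2 * (w * w) + M * (w * (s * s′))
    regroup₁ = solve-∀
    regroup₂ : ∀ f y → 2 * (suc (f + f) * suc (f + f)) + y ≡ 2 + (8 * (suc f * f) + y)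
    regroup₂ = solve-∀
    regroup₃ : ∀ z M y → 2 + (8 * (z * M) + M * y) ≡ 2 + M * (8 * z + y)
    regroup₃ = solve-∀

  -- Twice `n` exceeds the sum w r^(2+j) of the top row by r^(2+j); by `row≤` the lower rows absorb
  -- this excess together with 4h.
  2n+4h≤σ : n + n + (h * 2 + h * 2) ≤ σ
  2n+4h≤σ = begin
    n + n + (h * 2 + h * 2)
      ≡⟨ regroup₁ (2 ^ a) (r ^ (2 + j)) (h * 2 + h * 2) ⟩
    (2 ^ a + 2 ^ a) * r ^ (2 + j) + (h * 2 + h * 2)
      ≡⟨ cong (λ u → (2 ^ a + u) * r ^ (2 + j) + (h * 2 + h * 2)) (2^≡1+geo a) ⟩
    (2 ^ a + suc f) * r ^ (2 + j) + (h * 2 + h * 2)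
      ≡⟨ regroup₂ (2 ^ a) f (r ^ (2 + j)) (h * 2 + h * 2) ⟩
    w * r ^ (2 + j) + (r ^ (2 + j) + (h * 2 + h * 2))
      ≤⟨ +-monoʳ-≤ (w * r ^ (2 + j)) (row≤ h a 3r≤w j) ⟩
    w * r ^ (2 + j) + suc (sum (properRows r a j))
      ≡⟨ cong (_+_ (w * r ^ (2 + j))) (sum-properRows r a j) ⟩
    w * r ^ (2 + j) + w * geo r (2 + j)
      ≡⟨ *-distribˡ-+ w (r ^ (2 + j)) (geo r (2 + j)) ⟨
    σ ∎
    where
    open ≤-Reasoning
    regroup₁ : ∀ x u y → x * u + x * u + y ≡ (x + x) * u + y
    regroup₁ = solve-∀
    regroup₂ : ∀ x f u y → (x + suc f) * u + y ≡ (x + f) * u + (u + y)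
    regroup₂ = solve-∀

  2h≤P : h * 2 ≤ P
  2h≤P = *-cancelˡ-≤ M (s≤s⁻¹ (s≤s⁻¹ (begin
    2 + M * (h * 2)   ≤⟨ +-monoˡ-≤ (M * (h * 2)) 1<M ⟩
    M + M * (h * 2)   ≡⟨ *-suc M (h * 2) ⟨
    M * r             ≤⟨ Mr≤f ⟩
    f                 ≤⟨ m≤n+m f (2 ^ a) ⟩
    w                 ≤⟨ m≤m*n w (geo r (3 + j)) {{geo≢0}} ⟩
    σ                 ≡⟨ σ≡2+MP ⟩
    2 + M * P         ∎)))
    where
    open ≤-Reasoning
    geo≢0 : NonZero (geo r (3 + j))
    geo≢0 = >-nonZero (≤-trans (m^n>0 r (2 + j)) (m≤m+n (r ^ (2 + j)) (geo r (2 + j))))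

  -- Doubled: 2 + 2P ≤ 2 + MP = σ because M ≥ 2, and the remaining 2n + 4h is at most σ.
  P+2h≤ΣL : P + h * 2 ≤ sum L
  P+2h≤ΣL = s≤s⁻¹ (+-cancelˡ-≤ n _ _ (*-cancelˡ-≤ 2 (begin
    2 * (n + suc (P + h * 2))
      ≡⟨ regroup n P (h * 2) ⟩
    2 + 2 * P + (n + n + (h * 2 + h * 2))
      ≤⟨ +-mono-≤ (s≤s (s≤s (*-monoˡ-≤ P 1<M))) 2n+4h≤σ ⟩
    2 + M * P + σ
      ≡⟨ cong₂ _+_ (sym σ≡2+MP) (sym (+-identityʳ σ)) ⟩
    2 * σ
      ≡⟨ cong (2 *_) σ≡n+1+ΣL ⟩
    2 * (n + suc (sum L)) ∎)))
    where
    open ≤-Reasoning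
    regroup : ∀ n P x → 2 * (n + suc (P + x)) ≡ 2 + 2 * P + (n + n + (x + x))
    regroup = solve-∀

  inner↭L : innerDivisors n ↭ L
  inner↭L = innerDivisors↭innerRows pr (2∤1+n*2 h) a j 1<n

  subsetSum : SubsetSum (innerDivisors n) P
  subsetSum = SubsetSum-resp-↭ (↭-sym inner↭L) (covers-innerRows h a 3r≤w j P 2h≤P P+2h≤ΣL)

  1+MP≡ : 1 + M * P ≡ n + sum (innerDivisors n)
  1+MP≡ = suc-injective (begin
    2 + M * P                        ≡⟨ σ≡2+MP ⟨
    σ                                ≡⟨ σ≡n+1+ΣL ⟩
    n + suc (sum L)                  ≡⟨ +-suc n (sum L) ⟩
    suc (n + sum L)                  ≡⟨ cong (λ u → suc (n + u)) (sum-↭ inner↭L) ⟨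
    suc (n + sum (innerDivisors n))  ∎)
    where open ≡-Reasoning

∃-subsetSum : ∀ M → 1 < M → ∀ N → Solution M N
∃-subsetSum M 1<M N = fromPrime (∃-odd-prime≡1 M 1<M)
  where
  fromPrime : ∃[ h ] Prime (suc (h * 2)) × M ∣ h * 2 → Solution M N
  fromPrime (h , pr , divides s 2h≡sM) =
    fromExponent (∃-idempotent-2^ M {{>-nonZero (<-trans z<s 1<M)}} (M * suc (h * 2) + N))
    where
    fromExponent : ∃[ a ] M * suc (h * 2) + N ≤ geo 2 a × M ∣ 2 ^ a * geo 2 a → Solution M N
    fromExponent (a , K≤f , divides z 2^a*f≡zM) = n , N<n , 1<n , P , subsetSum , 1+MP≡
      where open Construction M 1<M N h pr s 2h≡sM a K≤f z 2^a*f≡zM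

-- From subset sums to coefficients

open import Data.Integer.Base using (+_)

-- Adding the total of the list makes a skipped entry contribute -d + d = 0 and a taken one m d + d
-- = (1 + m) d.
coefficients : ∀ m {xs s} → SubsetSum xs s →
  Σ[ c ∈ (Fin.Fin (length xs) → ℤ) ] (∀ j → c j ∈ₚ ｛ -1ℤ ｝ ∪ ｛ m ｝) ×
    ∑[ j < length xs ] (c j ℤ.* + lookup xs j) ℤ.+ + sum xs ≡ (1ℤ ℤ.+ m) ℤ.* + s
coefficients m [] = (λ ()) , (λ ()) , sym (ℤ.*-zeroʳ (1ℤ ℤ.+ m))
coefficients m (skip {xs} {s} {d} σ) with c , c∈ , eq ← coefficients m σ =
  (λ { Fin.zero → -1ℤ ; (Fin.suc j) → c j }) ,
  (λ { Fin.zero → inj₁ refl ; (Fin.suc j) → c∈ j }) ,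
  trans (regroup (+ d) (∑[ j < length xs ] (c j ℤ.* + lookup xs j)) (+ sum xs)) eq
  where
  regroup : ∀ d S t → -1ℤ ℤ.* d ℤ.+ S ℤ.+ (d ℤ.+ t) ≡ S ℤ.+ t
  regroup = ℤ-Solver.solve-∀
coefficients m (take {xs} {s} {d} σ) with c , c∈ , eq ← coefficients m σ =
  (λ { Fin.zero → m ; (Fin.suc j) → c j }) ,
  (λ { Fin.zero → inj₂ refl ; (Fin.suc j) → c∈ j }) ,
  trans (regroup m (+ d) (∑[ j < length xs ] (c j ℤ.* + lookup xs j)) (+ sum xs))
    (trans (cong (ℤ._+_ ((1ℤ ℤ.+ m) ℤ.* + d)) eq) (sym (ℤ.*-distribˡ-+ (1ℤ ℤ.+ m) (+ d) (+ s))))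
  where
  regroup : ∀ m d S t → m ℤ.* d ℤ.+ S ℤ.+ (d ℤ.+ t) ≡ (1ℤ ℤ.+ m) ℤ.* d ℤ.+ (S ℤ.+ t)
  regroup = ℤ-Solver.solve-∀

subsetSum⇒perfect : ∀ m {n P} → 1 < n → SubsetSum (innerDivisors n) P →
                    1 + suc m * P ≡ n + sum (innerDivisors n) →
                    n ∈ₚ Perfect (｛ -1ℤ ｝ ∪ ｛ + m ｝)
subsetSum⇒perfect m {n} {P} 1<n σ eq with c , c∈ , eq′ ← coefficients (+ m) σ =
  1<n , c , c∈ , ∙-cancelʳ (+ sum D) _ _ (begin
    1ℤ ℤ.+ S ℤ.+ + sum D        ≡⟨ ℤ.+-assoc 1ℤ S (+ sum D) ⟩
    1ℤ ℤ.+ (S ℤ.+ + sum D)      ≡⟨ cong (ℤ._+_ 1ℤ) eq′ ⟩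
    1ℤ ℤ.+ + suc m ℤ.* + P      ≡⟨ cong (ℤ._+_ 1ℤ) (ℤ.pos-* (suc m) P) ⟨
    + (1 + suc m * P)           ≡⟨ cong +_ eq ⟩
    + (n + sum D)               ≡⟨ ℤ.pos-+ n (sum D) ⟩
    + n ℤ.+ + sum D             ∎)
  where
  open ≡-Reasoning
  D = innerDivisors n
  S = ∑[ j < length D ] (c j ℤ.* + lookup D j)

corollary11 : (m : ℤ) → 1ℤ ℤ.≤ m → InfinitelyMany (Perfect (｛ -1ℤ ｝ ∪ ｛ m ｝))
-- The given integer is `suc m` here, so `M` is `2 + m`.
corollary11 (+ suc m)  _        N = perfect (∃-subsetSum (2 + m) (s<s z<s) N)
  where
  perfect : Solution (2 + m) N →
            ∃[ n ] N < n × n ∈ₚ Perfect (｛ -1ℤ ｝ ∪ ｛ + suc m ｝)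
  perfect (n , N<n , 1<n , P , σ , eq) = n , N<n , subsetSum⇒perfect (suc m) {n} {P} 1<n σ eq
corollary11 (+ zero) (+≤+ ()) N
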